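{- Let $\{R_m\}_{m\ge 0}$ be the Perrin sequence. The pair $(n,x)=(4,5)$ is the only pair such that $n$ is a non-negative integer, $x$ is a Perrin number (that is, $x=R_m$ for some integer $m\ge 0$), and $n!+1=x^{2}$.
   Context: The Perrin sequence $\{R_m\}_{m\ge 0}$ is defined by $R_0=3$, $R_1=0$, $R_2=2$ and $R_{m+3}=R_{m+1}+R_m$ for all $m\ge 0$. Its first terms are $3,0,2,3,2,5,5,7,10,12,17,22,\ldots$. Uniqueness refers to the pair $(n,x)$, not to the index $m$ (note that $5=R_5=R_6$). -}

module Defs where

open import Data.Nat using (ℕ; suc; _+_)
open import Data.Product using (∃-syntax)
open import Relation.Binary.PropositionalEquality using (_≡_)

R : ℕ → ℕ
R 0 = 3
R 1 = 0
R 2 = 2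
R (suc (suc (suc m))) = R (suc m) + R m

IsPerrin : ℕ → Set
IsPerrin x = ∃[ m ] x ≡ R m

{-# OPTIONS --safe #-}

-- Extended to negative indices, R takes the values ±1 at −1, −2, −7, −11 and −29. If n ≥ 53 then
-- R m² ≡ 1 modulo 9 · 53, where R has period 1404, and this forces m to be congruent modulo 13
-- to one of these five indices. All five are simple 3-adic zeros of R² − 1, because
-- R (m + 13 · 3ᵏ) ≡ R m modulo 3ᵏ⁺¹ with a difference controlled modulo 3ᵏ⁺². Hence 3ᵏ⁺¹ ∣ n!
-- forces m to agree with one of them modulo 13 · 3ᵏ, so m is exponential in n and R m² is far
-- larger than n! + 1. For n < 53 the numbers n! + 1 are inspected one by one.

module Submission where

open import Data.Empty using (⊥)
open import Data.Integer as ℤ using (ℤ)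
import Data.Integer.Properties as ℤ
open import Data.Nat as ℕ using (ℕ; zero; suc)
open import Data.Nat.Divisibility
open import Data.Nat.Primality using (Prime; prime?; euclidsLemma)
import Data.Nat.Properties as ℕ
open import Data.Product using (_×_; _,_; proj₁; proj₂; ∃-syntax)
open import Data.Sum using (_⊎_; inj₁; inj₂; [_,_]′)
open import Data.Unit using (tt)
open import Function using (id)
open import Relation.Binary.PropositionalEquality using (_≡_; _≢_; refl; sym; trans; cong; cong₂; subst; subst₂; module ≡-Reasoning)
open import Relation.Nullary using (contradiction; yes; no)
open import Relation.Nullary.Decidable using (False; toWitness; toWitnessFalse; ¬?; _⊎-dec_; _×-dec_)

module RecurrentSequences where
  open import Algebra.Bundles using (AbelianGroup)
  open import Algebra.Properties.Group (AbelianGroup.group ℤ.+-0-abelianGroup) using (∙-cancelˡ)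
  open import Data.Integer using (+_; _+_; _*_; -_; ∣_∣)
  open import Data.Integer.Tactic.RingSolver using (solve-∀)
  open import Data.Nat.Tactic.RingSolver using () renaming (solve-∀ to ℕ-solve-∀)

  -- Integer solutions of the recurrence and the ring of residues modulo x³ - x - 1.

  Recurrent : (ℕ → ℤ) → Set
  Recurrent u = ∀ i → u (3 ℕ.+ i) ≡ u (1 ℕ.+ i) + u i

  -- x¹³ = 1 + 3 (2 + 4 x + 3 x²) modulo x³ − x − 1.
  slope : (ℕ → ℤ) → ℕ → ℤ
  slope u i = + 2 * u i + + 4 * u (1 ℕ.+ i) + + 3 * u (2 ℕ.+ i)

  slope-recurrent : ∀ {u} → Recurrent u → Recurrent (slope u)
  slope-recurrent {u} rec i rewrite rec (2 ℕ.+ i) | rec (1 ℕ.+ i) | rec i =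
    lemma (u i) (u (1 ℕ.+ i)) (u (2 ℕ.+ i))
    where
    lemma : ∀ a b c →
      + 2 * (b + a) + + 4 * (c + b) + + 3 * ((b + a) + c)
      ≡ (+ 2 * b + + 4 * c + + 3 * (b + a)) + (+ 2 * a + + 4 * b + + 3 * c)
    lemma = solve-∀

  -- The coefficients of xⁿ modulo x³ − x − 1.
  coefficients : ℕ → ℤ × ℤ × ℤ
  coefficients zero    = + 1 , + 0 , + 0
  coefficients (suc n) = let (a , b , c) = coefficients n in c , a + c , b

  -- Multiplication by x acts as the index shift, so reducing a power of x gives an identity for
  -- every solution at once.
  unroll : ∀ {u} → Recurrent u → ∀ n i → let (a , b , c) = coefficients n in
    u (n ℕ.+ i) ≡ a * u i + b * u (1 ℕ.+ i) + c * u (2 ℕ.+ i)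
  unroll {u} rec zero i = lemma (u i) (u (1 ℕ.+ i)) (u (2 ℕ.+ i))
    where
    lemma : ∀ x y z → x ≡ + 1 * x + + 0 * y + + 0 * z
    lemma = solve-∀
  unroll {u} rec (suc n) i with coefficients n | unroll {u} rec n (suc i)
  ... | a , b , c | eq rewrite ℕ.+-suc n i | rec i =
    trans eq (lemma a b c (u i) (u (1 ℕ.+ i)) (u (2 ℕ.+ i)))
    where
    lemma : ∀ a b c x y z → a * y + b * z + c * (y + x) ≡ c * x + (a + c) * y + b * z
    lemma = solve-∀

  -- Shifts of the index by 13 · 3ᵏ, expanded 3-adically.

  shift-13 : ∀ {u} → Recurrent u → ∀ i → u (13 ℕ.+ i) ≡ u i + + 3 * slope u i
  shift-13 {u} rec i = trans (unroll {u} rec 13 i) (lemma (u i) (u (1 ℕ.+ i)) (u (2 ℕ.+ i)))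
    where
    -- 7, 12 and 9 are the entries of `coefficients 13`.
    lemma : ∀ x y z → + 7 * x + + 12 * y + + 9 * z ≡ x + + 3 * (+ 2 * x + + 4 * y + + 3 * z)
    lemma = solve-∀

  -- With E the shift by `N`, (E - 1) / 3q sends solutions to solutions and acts as `slope` modulo
  -- 3. As `diff` is again recurrent, the operator can be iterated.
  record Shift (N : ℕ) (q : ℤ) (u : ℕ → ℤ) : Set where
    field
      diff       : ℕ → ℤ
      recurrent  : Recurrent diff
      shift      : ∀ i → u (N ℕ.+ i) ≡ u i + + 3 * q * diff i
      diff≡slope : ∀ i → ∃[ z ] diff i ≡ slope u i + + 3 * z

  Shifts : ℕ → ℤ → Set
  Shifts N q = ∀ u → Recurrent u → Shift N q u

  shifts-13 : Shifts 13 (+ 1)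
  shifts-13 u rec = record
    { diff       = slope u
    ; recurrent  = slope-recurrent {u} rec
    ; shift      = shift-13 {u} rec
    ; diff≡slope = λ i → + 0 , sym (ℤ.+-identityʳ _)
    }

  -- Writing E for the shift by N, this is E³ − 1 = 3(E − 1) + 3(E − 1)² + (E − 1)³.
  shifts-triple : ∀ {N q} → Shifts N q → Shifts (3 ℕ.* N) (+ 3 * q)
  shifts-triple {N} {q} S u rec = record
    { diff       = λ i → v i + + 3 * (q * w i + q * q * z i)
    ; recurrent  = λ i → trans
        (cong₂ _+_ (V.recurrent i)
          (cong₂ (λ a b → + 3 * (q * a + q * q * b)) (W.recurrent i) (Z.recurrent i)))
        (linear (v i) (w i) (z i) (v (1 ℕ.+ i)) (w (1 ℕ.+ i)) (z (1 ℕ.+ i)) q)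
    ; shift      = shift³
    ; diff≡slope = λ i → let (a , eq) = V.diff≡slope i ; b = q * w i + q * q * z i in
        a + b , trans (cong (_+ + 3 * b) eq) (collect (slope u i) a b)
    }
    where
    module V = Shift (S u rec)
    module W = Shift (S V.diff V.recurrent)
    module Z = Shift (S W.diff W.recurrent)
    v = V.diff
    w = W.diff
    z = Z.diff
    linear : ∀ a b c a′ b′ c′ q →
      (a′ + a) + + 3 * (q * (b′ + b) + q * q * (c′ + c))
      ≡ (a′ + + 3 * (q * b′ + q * q * c′)) + (a + + 3 * (q * b + q * q * c))
    linear = solve-∀
    collect : ∀ a b c → a + + 3 * b + + 3 * c ≡ a + + 3 * (b + c)
    collect = solve-∀
    index : ∀ N i → 3 ℕ.* N ℕ.+ i ≡ N ℕ.+ (N ℕ.+ (N ℕ.+ i))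
    index = ℕ-solve-∀
    cube : ∀ a b c d q →
      a + + 3 * q * b + + 3 * q * (b + + 3 * q * c)
        + + 3 * q * (b + + 3 * q * c + + 3 * q * (c + + 3 * q * d))
      ≡ a + + 3 * (+ 3 * q) * (b + + 3 * (q * c + q * q * d))
    cube = solve-∀
    open ≡-Reasoning
    shift² : ∀ {f g h} → (∀ i → f (N ℕ.+ i) ≡ f i + + 3 * q * g i) →
             (∀ i → g (N ℕ.+ i) ≡ g i + + 3 * q * h i) →
             ∀ i → f (N ℕ.+ (N ℕ.+ i)) ≡ f i + + 3 * q * g i + + 3 * q * (g i + + 3 * q * h i)
    shift² f-shift g-shift i =
      trans (f-shift (N ℕ.+ i)) (cong₂ (λ a b → a + + 3 * q * b) (f-shift i) (g-shift i))
    shift³ : ∀ i → u (3 ℕ.* N ℕ.+ i) ≡ u i + + 3 * (+ 3 * q) * (v i + + 3 * (q * w i + q * q * z i))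
    shift³ i = begin
      u (3 ℕ.* N ℕ.+ i)
        ≡⟨ cong u (index N i) ⟩
      u (N ℕ.+ (N ℕ.+ (N ℕ.+ i)))
        ≡⟨ V.shift (N ℕ.+ (N ℕ.+ i)) ⟩
      u (N ℕ.+ (N ℕ.+ i)) + + 3 * q * v (N ℕ.+ (N ℕ.+ i))
        ≡⟨ cong₂ (λ a b → a + + 3 * q * b) (shift² {u} {v} {w} V.shift W.shift i) (shift² {v} {w} {z} W.shift Z.shift i) ⟩
      _ ≡⟨ cube (u i) (v i) (w i) (z i) q ⟩
      u i + + 3 * (+ 3 * q) * (v i + + 3 * (q * w i + q * q * z i)) ∎

  shifts : ∀ k → Shifts (3 ℕ.^ k ℕ.* 13) (+ (3 ℕ.^ k))
  shifts zero    = shifts-13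
  shifts (suc k) = subst₂ Shifts (sym (ℕ.*-assoc 3 (3 ℕ.^ k) 13)) (sym (ℤ.pos-* 3 (3 ℕ.^ k)))
                     (shifts-triple (shifts k))

  module _ {N q} (S : Shifts N q) (u : ℕ → ℤ) (rec : Recurrent u) where
    private
      module V = Shift (S u rec)
      v = V.diff

    -- Each jump by `N` adds a multiple of 3. Applied to `diff` in `shift-multiple`, this trades the
    -- intermediate indices for `i`.
    shift-multiple-mod-3 : ∀ s i → ∃[ z ] u (s ℕ.* N ℕ.+ i) ≡ u i + + 3 * z
    shift-multiple-mod-3 zero i = + 0 , sym (ℤ.+-identityʳ _)
    shift-multiple-mod-3 (suc s) i with shift-multiple-mod-3 s i
    ... | z , eq = z + q * v (s ℕ.* N ℕ.+ i) , (begin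
      u (N ℕ.+ s ℕ.* N ℕ.+ i)      ≡⟨ cong u (ℕ.+-assoc N (s ℕ.* N) i) ⟩
      u (N ℕ.+ (s ℕ.* N ℕ.+ i))    ≡⟨ V.shift (s ℕ.* N ℕ.+ i) ⟩
      u (s ℕ.* N ℕ.+ i) + + 3 * q * v (s ℕ.* N ℕ.+ i)
                                   ≡⟨ cong (_+ + 3 * q * v (s ℕ.* N ℕ.+ i)) eq ⟩
      u i + + 3 * z + + 3 * q * v (s ℕ.* N ℕ.+ i)
                                   ≡⟨ lemma (u i) q z (v (s ℕ.* N ℕ.+ i)) ⟩
      u i + + 3 * (z + q * v (s ℕ.* N ℕ.+ i)) ∎)
      where
      open ≡-Reasoning
      lemma : ∀ a q b c → a + + 3 * b + + 3 * q * c ≡ a + + 3 * (b + q * c)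
      lemma = solve-∀

  -- Telescoping: each of the `s` jumps contributes 3q times a difference congruent to `slope u i`
  -- modulo 3, so the total change is linear in `s` modulo 9q.
  shift-multiple : ∀ {N q} → Shifts N q → ∀ u → Recurrent u → ∀ s i → ∃[ z ]
    u (s ℕ.* N ℕ.+ i) ≡ u i + + 3 * q * (+ s * slope u i + + 3 * z)
  shift-multiple {N} {q} S u rec zero i = + 0 , lemma (u i) q (slope u i)
    where
    lemma : ∀ a b c → a ≡ a + + 3 * b * (+ 0 * c + + 3 * + 0)
    lemma = solve-∀
  shift-multiple {N} {q} S u rec (suc s) i
    with shift-multiple S u rec s i
       | Shift.diff≡slope (S u rec) i
       | shift-multiple-mod-3 S (Shift.diff (S u rec)) (Shift.recurrent (S u rec)) s i
  ... | z , eq | a , eqᵃ | b , eqᵇ = z + (a + b) , (begin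
      u (N ℕ.+ s ℕ.* N ℕ.+ i)      ≡⟨ cong u (ℕ.+-assoc N (s ℕ.* N) i) ⟩
      u (N ℕ.+ (s ℕ.* N ℕ.+ i))    ≡⟨ V.shift (s ℕ.* N ℕ.+ i) ⟩
      u (s ℕ.* N ℕ.+ i) + + 3 * q * V.diff (s ℕ.* N ℕ.+ i)
        ≡⟨ cong₂ (λ x y → x + + 3 * q * y) eq (trans eqᵇ (cong (_+ + 3 * b) eqᵃ)) ⟩
      u i + + 3 * q * (+ s * d + + 3 * z) + + 3 * q * (d + + 3 * a + + 3 * b)
        ≡⟨ lemma (u i) q (+ s) d z a b ⟩
      u i + + 3 * q * ((+ 1 + + s) * d + + 3 * (z + (a + b)))  ∎)
      where
      open ≡-Reasoning
      module V = Shift (S u rec)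
      d = slope u i
      lemma : ∀ a q s d z x b →
        a + + 3 * q * (s * d + + 3 * z) + + 3 * q * (d + + 3 * x + + 3 * b)
        ≡ a + + 3 * q * ((+ 1 + s) * d + + 3 * (z + (x + b)))
      lemma = solve-∀

  -- Hensel-type lifting at a simple zero of u² - 1.

  3-prime : Prime 3
  3-prime = toWitness {a? = prime? 3} tt

  module _ (a c q : ℤ) (s : ℕ) (z t x : ℤ) where
    private
      d = + s * c + + 3 * z
      e = + 2 * a * d + + 3 * q * d * d
      f = + 2 * a * z + q * d * d
      open ≡-Reasoning

      expand : ∀ a q d → (a + + 3 * q * d) * (a + + 3 * q * d)
                         ≡ a * a + + 3 * q * (+ 2 * a * d + + 3 * q * d * d)
      expand = solve-∀
      regroup : ∀ q t → + 3 * (+ 3 * q) * t ≡ + 3 * q * (+ 3 * t)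
      regroup = solve-∀
      separate : ∀ a c s z q d → + 2 * a * c * s ≡
        + 2 * a * (s * c + + 3 * z) + + 3 * q * d * d + - (+ 3 * (+ 2 * a * z + q * d * d))
      separate = solve-∀
      factor : ∀ t x → + 3 * t + - (+ 3 * x) ≡ (t + - x) * + 3
      factor = solve-∀

    -- Cancelling 3q between the two forms of x² - 1 leaves 2ad + 3qd² = 3t, and `d` is congruent to
    -- sc modulo 3.
    first-order-term : {{_ : ℤ.NonZero (+ 3 * q)}} → a * a ≡ + 1 → x ≡ a + + 3 * q * d →
      x * x ≡ + 1 + + 3 * (+ 3 * q) * t → 3 ∣ ∣ + 2 * a * c ∣ ℕ.* s
    first-order-term unit eqˣ eq = divides ∣ t + - f ∣ (begin
      ∣ + 2 * a * c ∣ ℕ.* s    ≡⟨ ℤ.abs-* (+ 2 * a * c) (+ s) ⟨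
      ∣ + 2 * a * c * + s ∣    ≡⟨ cong ∣_∣ (separate a c (+ s) z q d) ⟩
      ∣ e + - (+ 3 * f) ∣      ≡⟨ cong (λ y → ∣ y + - (+ 3 * f) ∣) cancelled ⟩
      ∣ + 3 * t + - (+ 3 * f) ∣  ≡⟨ cong ∣_∣ (factor t f) ⟩
      ∣ (t + - f) * + 3 ∣      ≡⟨ ℤ.abs-* (t + - f) (+ 3) ⟩
      ∣ t + - f ∣ ℕ.* 3        ∎)
      where
      cancelled : e ≡ + 3 * t
      cancelled = ℤ.*-cancelˡ-≡ (+ 3 * q) e (+ 3 * t)
        (∙-cancelˡ (+ 1) (+ 3 * q * e) (+ 3 * q * (+ 3 * t)) (begin
          + 1 + + 3 * q * e                      ≡⟨ cong (_+ + 3 * q * e) unit ⟨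
          a * a + + 3 * q * e                    ≡⟨ expand a q d ⟨
          (a + + 3 * q * d) * (a + + 3 * q * d)  ≡⟨ cong (λ y → y * y) eqˣ ⟨
          x * x                                  ≡⟨ eq ⟩
          + 1 + + 3 * (+ 3 * q) * t              ≡⟨ cong (_+_ (+ 1)) (regroup q t) ⟩
          + 1 + + 3 * q * (+ 3 * t)              ∎))

  -- Along the indices 13s + i₀, the quotient (u² - 1) / 3 is linear in s modulo 3, with the
  -- coefficient that `simple` keeps prime to 3.
  module Lifting (u : ℕ → ℤ) (rec : Recurrent u) (i₀ : ℕ) (unit : u i₀ * u i₀ ≡ + 1)
    (simple : 3 ∤ ∣ + 2 * u i₀ * slope u i₀ ∣) where

    3∣multiplier : ∀ k s t → let i = s ℕ.* (3 ℕ.^ k ℕ.* 13) ℕ.+ i₀ in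
      u i * u i ≡ + 1 + + 3 * (+ 3 * + (3 ℕ.^ k)) * t → 3 ∣ s
    3∣multiplier k s t eq =
      let z , eqᶻ = shift-multiple (shifts k) u rec s i₀
          instance 3^suc≢0 = subst ℤ.NonZero (ℤ.pos-* 3 (3 ℕ.^ k)) (ℕ.m^n≢0 3 (suc k))
      in [ (λ 3∣2ac → contradiction 3∣2ac simple) , id ]′
           (euclidsLemma _ s 3-prime
             (first-order-term (u i₀) (slope u i₀) (+ (3 ℕ.^ k)) s z t
                (u (s ℕ.* (3 ℕ.^ k ℕ.* 13) ℕ.+ i₀)) unit eqᶻ eq))

    -- Induction on `k`: the congruence with one factor 3 less gives s = s′ · 3ᵏ, and the full one,
    -- read as s′ jumps of length 13 · 3ᵏ, gives 3 ∣ s′. The modulus is one power of 3 ahead of the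
    -- conclusion because a jump by 13 already preserves `u` modulo 3.
    lift : ∀ k s t → u (s ℕ.* 13 ℕ.+ i₀) * u (s ℕ.* 13 ℕ.+ i₀) ≡ + 1 + + 3 * + (3 ℕ.^ k) * t →
           3 ℕ.^ k ∣ s
    lift zero s t eq = 1∣ s
    lift (suc k) s t eq with lift k s (+ 3 * t) (trans eq (cong (_+_ (+ 1)) (begin
        + 3 * + (3 ℕ.^ suc k) * t      ≡⟨ cong (λ x → + 3 * x * t) (ℤ.pos-* 3 (3 ℕ.^ k)) ⟩
        + 3 * (+ 3 * + (3 ℕ.^ k)) * t  ≡⟨ regroup (+ (3 ℕ.^ k)) t ⟩
        + 3 * + (3 ℕ.^ k) * (+ 3 * t)  ∎)))
      where
      open ≡-Reasoning
      regroup : ∀ q t → + 3 * (+ 3 * q) * t ≡ + 3 * q * (+ 3 * t)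
      regroup = solve-∀
    ... | divides s′ refl =
      *-monoˡ-∣ (3 ℕ.^ k) (3∣multiplier k s′ t
        (subst₂ (λ j q → u (j ℕ.+ i₀) * u (j ℕ.+ i₀) ≡ + 1 + + 3 * q * t)
          (ℕ.*-assoc s′ (3 ℕ.^ k) 13) (ℤ.pos-* 3 (3 ℕ.^ k)) eq))

open RecurrentSequences

open import Defs
open import Data.Bool using (Bool; true; false; _∧_; _∨_; not; if_then_else_; T)
open import Data.Bool.Properties using (T-∧)
open import Data.Nat using (_+_; _*_; _^_; _!; _≤_; _<_; z≤n; s≤s; _≤′_; ≤′-reflexive; ≤′-step; _≤ᵇ_; _≡ᵇ_; NonZero)
open import Data.Nat.DivMod
open import Data.Nat.Properties
open import Data.Nat.Tactic.RingSolver using (solve-∀)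
open import Function.Bundles using (_⇔_; mk⇔; Equivalence)

-- Growth of the Perrin sequence against the factorial.

-- Expressed through three consecutive terms, `R (8 + m)` is the first later term whose coefficient
-- at `R m` reaches 2.
R-double : ∀ m → 2 * R m ≤ R (8 + m)
R-double m = subst (2 * R m ≤_) (lemma (R m) (R (1 + m)) (R (2 + m))) (m≤m+n (2 * R m) _)
  where
  lemma : ∀ a b c → 2 * a + (2 * c + 3 * b) ≡ ((c + b) + (b + a)) + ((b + a) + c)
  lemma = solve-∀

R-pos : ∀ m → 1 ≤ R (2 + m)
R-pos 0 = s≤s z≤n
R-pos 1 = s≤s z≤n
R-pos 2 = s≤s z≤n
R-pos (suc (suc (suc m))) = ≤-trans (R-pos m) (m≤n+m _ (R (3 + m)))

R-growth : ∀ t m → 2 ^ t ≤ R (t * 8 + (2 + m))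
R-growth zero    m = R-pos m
R-growth (suc t) m = ≤-trans (*-monoʳ-≤ 2 (R-growth t m)) (R-double (t * 8 + (2 + m)))

!≤^ : ∀ {b} n → n ≤ b → n ! ≤ b ^ n
!≤^ zero    n≤b = ≤-refl
!≤^ (suc n) n<b = *-mono-≤ n<b (!≤^ n (<⇒≤ n<b))

linear≤2^ : ∀ {k} → 5 ≤′ k → 3 * k + 5 ≤ 2 ^ k
linear≤2^ (≤′-reflexive refl) = m≤m+n 20 12
linear≤2^ {suc k} (≤′-step 5≤k) = begin
  3 * suc k + 5                  ≤⟨ m≤m+n (3 * suc k + 5) (3 * k + 2) ⟩
  3 * suc k + 5 + (3 * k + 2)    ≡⟨ lemma k ⟩
  2 * (3 * k + 5)                ≤⟨ *-monoʳ-≤ 2 (linear≤2^ 5≤k) ⟩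
  2 * 2 ^ k                      ∎
  where
  open ≤-Reasoning
  lemma : ∀ k → 3 * suc k + 5 + (3 * k + 2) ≡ 2 * (3 * k + 5)
  lemma = solve-∀

quadratic≤3^ : ∀ {k} → 5 ≤′ k → 4 + k * (3 * k + 5) ≤ 3 ^ k * 2
quadratic≤3^ (≤′-reflexive refl) = m≤m+n 104 382
quadratic≤3^ {suc k} (≤′-step 5≤k) = begin
  4 + suc k * (3 * suc k + 5)    ≤⟨ m≤m+n _ (6 * k * k + 4 * k) ⟩
  4 + suc k * (3 * suc k + 5) + (6 * k * k + 4 * k)
                                 ≡⟨ lemma k ⟩
  3 * (4 + k * (3 * k + 5))      ≤⟨ *-monoʳ-≤ 3 (quadratic≤3^ 5≤k) ⟩
  3 * (3 ^ k * 2)                ≡⟨ *-assoc 3 (3 ^ k) 2 ⟨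
  3 ^ suc k * 2                  ∎
  where
  open ≤-Reasoning
  lemma : ∀ k → 4 + suc k * (3 * suc k + 5) + (6 * k * k + 4 * k) ≡ 3 * (4 + k * (3 * k + 5))
  lemma = solve-∀

-- The chain is n! + 1 ≤ 2 · (2ᵏ)ⁿ < 4ᵗ ≤ (R m)². In the application `t` is 3ᵏ.
!+1<R² : ∀ {k n m t} → n ≤ 2 ^ k → 2 + k * n ≤ t * 2 → 31 ≤ t * 5 → t * 13 ≤ 29 + m →
         n ! + 1 < R m * R m
!+1<R² {k} {n} {m} {t} n≤2^k kn≤2t 31≤5t 13t≤29+m = begin-strict
  n ! + 1                    ≤⟨ +-mono-≤ (!≤^ n n≤2^k) (m^n>0 (2 ^ k) {{m^n≢0 2 k}} n) ⟩
  (2 ^ k) ^ n + (2 ^ k) ^ n  ≡⟨ cong ((2 ^ k) ^ n +_) (+-identityʳ _) ⟨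
  2 * (2 ^ k) ^ n            ≡⟨ cong (2 *_) (^-*-assoc 2 k n) ⟩
  2 ^ (1 + k * n)            <⟨ ^-monoʳ-< 2 (s≤s (s≤s z≤n)) kn≤2t ⟩
  2 ^ (t * 2)                ≡⟨ ^-*-assoc 2 t 2 ⟨
  (2 ^ t) ^ 2                ≡⟨ cong (2 ^ t *_) (*-identityʳ _) ⟩
  2 ^ t * 2 ^ t              ≤⟨ *-mono-≤ 2^t≤R 2^t≤R ⟩
  R m * R m                  ∎
  where
  open ≤-Reasoning
  -- A doubling costs 8 indices, while each unit of `t` provides 13; the surplus 5t pays for the
  -- offsets 29 and 2.
  8t+2≤m : t * 8 + 2 ≤ m
  8t+2≤m = +-cancelˡ-≤ 29 _ _ (begin
    29 + (t * 8 + 2)  ≡⟨ lemma₁ t ⟩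
    31 + t * 8        ≤⟨ +-monoˡ-≤ (t * 8) 31≤5t ⟩
    t * 5 + t * 8     ≡⟨ lemma₂ t ⟩
    t * 13            ≤⟨ 13t≤29+m ⟩
    29 + m            ∎)
    where
    lemma₁ : ∀ x → 29 + (x * 8 + 2) ≡ 31 + x * 8
    lemma₁ = solve-∀
    lemma₂ : ∀ x → x * 5 + x * 8 ≡ x * 13
    lemma₂ = solve-∀
  2^t≤R : 2 ^ t ≤ R m
  2^t≤R = let o , eq = m≤n⇒∃[o]m+o≡n 8t+2≤m in
    subst (λ j → 2 ^ t ≤ R j) (trans (sym (+-assoc (t * 8) 2 o)) eq) (R-growth t o)

-- Each block of three consecutive factors contains one multiple of 3. An exponent linear in n
-- suffices, as it makes the power of 3 exponential in n.
3^∣! : ∀ j → 3 ^ j ∣ (j * 3) !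
3^∣! zero    = 1∣ 1
3^∣! (suc j) = *-pres-∣ {3} {3 + j * 3} {3 ^ j} (n∣m*n (suc j))
  (∣n⇒∣m*n (2 + j * 3) (∣n⇒∣m*n (1 + j * 3) (3^∣! j)))

-- Periodic orbits and the Perrin sequence modulo 477.

module Cycle {A : Set} (f : A → A) (x : A) where
  orbit : ℕ → A
  orbit zero    = x
  orbit (suc n) = f (orbit n)

  orbit-+ : ∀ {p} → orbit p ≡ x → ∀ r → orbit (r + p) ≡ orbit r
  orbit-+ eq zero    = eq
  orbit-+ eq (suc r) = cong f (orbit-+ eq r)

  orbit-% : ∀ {p} .{{_ : NonZero p}} → orbit p ≡ x → ∀ n → orbit n ≡ orbit (n % p)
  orbit-% {p} eq n = trans (cong orbit (m≡m%n+[m/n]*n n p)) (multiples (n % p) (n / p))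
    where
    multiples : ∀ r s → orbit (r + s * p) ≡ orbit r
    multiples r zero    = cong orbit (+-identityʳ r)
    multiples r (suc s) = trans (cong orbit (trans (cong (r +_) (+-comm p (s * p))) (sym (+-assoc r (s * p) p))))
                                (trans (orbit-+ eq (r + s * p)) (multiples r s))

-- The current state is carried along, so a step of the check costs one application of `f` instead
-- of rebuilding the orbit from its start.
along : {A : Set} → (A → A) → (A → Bool) → ℕ → A → Bool
along f ok zero    x = true
along f ok (suc n) x = ok x ∧ along f ok n (f x)

along-sound : ∀ {A : Set} (f : A → A) ok n x → T (along f ok n x) →
              ∀ {m} → m < n → T (ok (Cycle.orbit f x m))
along-sound f ok (suc n) x h {zero}  _         = proj₁ (Equivalence.to T-∧ h)
along-sound f ok (suc n) x h {suc m} (s≤s m<n) =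
  subst (λ y → T (ok y)) (orbit-f m) (along-sound f ok n (f x) (proj₂ (Equivalence.to (T-∧ {ok x}) h)) m<n)
  where
  orbit-f : ∀ m → Cycle.orbit f (f x) m ≡ Cycle.orbit f x (suc m)
  orbit-f zero    = refl
  orbit-f (suc m) = cong f (orbit-f m)

-- An index modulo 13 together with three consecutive terms modulo 477.
State : Set
State = ℕ × ℕ × ℕ × ℕ

next : State → State
next (r , a , b , c) = suc r % 13 , b , c , (b + a) % 477

initial : State
initial = 0 , 3 , 0 , 2

open Cycle next initial using (orbit; orbit-%)

state : ℕ → State
state m = m % 13 , R m % 477 , R (1 + m) % 477 , R (2 + m) % 477

%-suc : ∀ m d .{{_ : NonZero d}} → suc (m % d) % d ≡ suc m % d
%-suc m d = sym (trans (cong (λ x → suc x % d) (m≡m%n+[m/n]*n m d)) ([m+kn]%n≡m%n (suc (m % d)) (m / d) d))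

orbit≡state : ∀ m → orbit m ≡ state m
orbit≡state zero    = refl
orbit≡state (suc m) = trans (cong next (orbit≡state m))
  (cong₂ (λ r c → r , R (1 + m) % 477 , R (2 + m) % 477 , c)
    (%-suc m 13) (sym (%-distribˡ-+ (R (1 + m)) (R m) 477)))

-- The residues modulo 13 of −11, −7, −29, −2 and −1, in this order.
admissible : ℕ → Bool
admissible 2  = true
admissible 6  = true
admissible 10 = true
admissible 11 = true
admissible 12 = true
admissible _  = false

check : State → Bool
check (r , a , _) = not (a * a % 477 ≡ᵇ 1) ∨ admissible r

-- The index component returns as well, since 1404 = 13 · 108.
orbit-1404 : orbit 1404 ≡ initial
orbit-1404 = refl

checked : T (along next check 1404 initial)
checked = tt

admissible-residue : ∀ m → R m * R m % 477 ≡ 1 → T (admissible (m % 13))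
admissible-residue m sq = conclude (subst (λ y → T (check y))
  (trans (sym (orbit-% {1404} orbit-1404 m)) (orbit≡state m))
  (along-sound next check 1404 initial checked (m%n<n m 1404)))
  where
  conclude : T (check (state m)) → T (admissible (m % 13))
  -- Once the square is known to be 1 modulo 477, the first alternative of `check` evaluates to
  -- false and the second remains.
  conclude h rewrite trans (sym (%-distribˡ-* (R m) (R m) 477)) sq = h

-- Extension to negative indices and the five 3-adic zeros.

-- R⁻ i is the term of index i − 29, so that the five zeros of R² − 1 sit at 0, 18, 22, 27 and 28.
R⁻ : ℕ → ℤ
R⁻ 0 = ℤ.-[1+ 0 ]
R⁻ 1 = ℤ.+ 67
R⁻ 2 = ℤ.-[1+ 87 ]
R⁻ (suc (suc (suc i))) = R⁻ (suc i) ℤ.+ R⁻ i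

R⁻-recurrent : Recurrent R⁻
R⁻-recurrent i = refl

R⁻≡R : ∀ m → R⁻ (29 + m) ≡ ℤ.+ R m
R⁻≡R 0 = refl
R⁻≡R 1 = refl
R⁻≡R 2 = refl
R⁻≡R (suc (suc (suc m))) = cong₂ ℤ._+_ (R⁻≡R (suc m)) (R⁻≡R m)

module _ (k m t : ℕ) (sq : R m * R m ≡ 1 + 3 * 3 ^ k * t) where

  -- In the indexing of `R⁻`, the term `R m` lies `s` jumps of 13 beyond the zero i₀, and `lift`
  -- gives 3ᵏ ∣ s. Writing `suc j` keeps `s` positive, which turns divisibility into 3ᵏ ≤ s.
  near-zero : ∀ i₀ → R⁻ i₀ ℤ.* R⁻ i₀ ≡ ℤ.+ 1 →
    {_ : False (3 ∣? ℤ.∣ ℤ.+ 2 ℤ.* R⁻ i₀ ℤ.* slope R⁻ i₀ ∣)} →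
    ∀ {r} q j → 29 + r ≡ suc j * 13 + i₀ → m ≡ r + q * 13 → 3 ^ k * 13 ≤ 29 + m
  near-zero i₀ unit {simple} {r} q j eqʳ eqᵐ =
    ≤-trans (*-monoˡ-≤ 13 (∣⇒≤ 3^k∣s)) (≤-trans (m≤m+n (s * 13) i₀) (≤-reflexive (sym eqˢ)))
    where
    open ≡-Reasoning
    s = suc (j + q)
    assemble : ∀ q j i₀ → q * 13 + (suc j * 13 + i₀) ≡ suc (j + q) * 13 + i₀
    assemble = solve-∀
    eqˢ : 29 + m ≡ s * 13 + i₀
    eqˢ = begin
      29 + m                       ≡⟨ cong (29 +_) eqᵐ ⟩
      29 + (r + q * 13)            ≡⟨ +-assoc 29 r (q * 13) ⟨
      29 + r + q * 13              ≡⟨ +-comm (29 + r) (q * 13) ⟩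
      q * 13 + (29 + r)            ≡⟨ cong (q * 13 +_) eqʳ ⟩
      q * 13 + (suc j * 13 + i₀)   ≡⟨ assemble q j i₀ ⟩
      s * 13 + i₀                  ∎
    R⁻≡Rm : R⁻ (s * 13 + i₀) ≡ ℤ.+ R m
    R⁻≡Rm = trans (cong R⁻ (sym eqˢ)) (R⁻≡R m)
    R⁻² : R⁻ (s * 13 + i₀) ℤ.* R⁻ (s * 13 + i₀) ≡ ℤ.+ 1 ℤ.+ ℤ.+ 3 ℤ.* ℤ.+ (3 ^ k) ℤ.* ℤ.+ t
    R⁻² = begin
      R⁻ (s * 13 + i₀) ℤ.* R⁻ (s * 13 + i₀)        ≡⟨ cong₂ ℤ._*_ R⁻≡Rm R⁻≡Rm ⟩
      ℤ.+ R m ℤ.* ℤ.+ R m                          ≡⟨ ℤ.pos-* (R m) (R m) ⟨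
      ℤ.+ (R m * R m)                              ≡⟨ cong ℤ.+_ sq ⟩
      ℤ.+ 1 ℤ.+ ℤ.+ (3 * 3 ^ k * t)                ≡⟨ cong (ℤ._+_ (ℤ.+ 1)) (ℤ.pos-* (3 * 3 ^ k) t) ⟩
      ℤ.+ 1 ℤ.+ ℤ.+ (3 * 3 ^ k) ℤ.* ℤ.+ t          ≡⟨ cong (λ x → ℤ.+ 1 ℤ.+ x ℤ.* ℤ.+ t) (ℤ.pos-* 3 (3 ^ k)) ⟩
      ℤ.+ 1 ℤ.+ ℤ.+ 3 ℤ.* ℤ.+ (3 ^ k) ℤ.* ℤ.+ t    ∎
    3^k∣s : 3 ^ k ∣ s
    3^k∣s = Lifting.lift R⁻ R⁻-recurrent i₀ unit (toWitnessFalse simple) k s (ℤ.+ t) R⁻²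

  index-large : T (admissible (m % 13)) → 3 ^ k * 13 ≤ 29 + m
  index-large h = by-residue (m % 13) h (m≡m%n+[m/n]*n m 13)
    where
    by-residue : ∀ r → T (admissible r) → m ≡ r + m / 13 * 13 → 3 ^ k * 13 ≤ 29 + m
    -- The last number is (29 + r - i₀) / 13 - 1; for r = 10 it is 2, as 39 = 3 · 13 + 0.
    by-residue 2  _ = near-zero 18 refl (m / 13) 0 refl
    by-residue 6  _ = near-zero 22 refl (m / 13) 0 refl
    by-residue 10 _ = near-zero 0  refl (m / 13) 2 refl
    by-residue 11 _ = near-zero 27 refl (m / 13) 0 refl
    by-residue 12 _ = near-zero 28 refl (m / 13) 0 refl

-- Factorials below 53!.

-- One binary digit of the root per unit of fuel. This only proposes a candidate: `near-square`
-- verifies the enclosing inequalities for each value.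
sqrt : ℕ → ℕ → ℕ
sqrt zero       n = 0
sqrt (suc fuel) n = round (2 * sqrt fuel (n / 4))
  where
  round : ℕ → ℕ
  round r = if suc r * suc r ≤ᵇ n then suc r else r

BetweenSquares : ℕ → ℕ → Set
BetweenSquares s n = s * s < n × n < suc s * suc s

between-squares : ∀ {s n} x → BetweenSquares s n → n ≢ x * x
between-squares {s} x (s²<n , n<[s+1]²) refl with x ≤? s
... | yes x≤s = <⇒≱ s²<n (*-mono-≤ x≤s x≤s)
... | no  x≰s = <⇒≱ n<[s+1]² (*-mono-≤ (≰⇒> x≰s) (≰⇒> x≰s))

-- 120 binary digits are enough, since 52! + 1 < 4¹²⁰.
root : ℕ → ℕ
root n = sqrt 120 (n ! + 1)

-- The exceptions are the squares 4! + 1 = 5², 5! + 1 = 11² and 7! + 1 = 71².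
near-square : ∀ {n} → n < 53 → (n ≡ 4 ⊎ n ≡ 5 ⊎ n ≡ 7) ⊎ BetweenSquares (root n) (n ! + 1)
near-square = toWitness {a? = allUpTo? (λ n → ((n ≟ 4) ⊎-dec (n ≟ 5) ⊎-dec (n ≟ 7))
  ⊎-dec ((root n * root n <? n ! + 1) ×-dec (n ! + 1 <? suc (root n) * suc (root n)))) 53} tt

-- Three consecutive terms above 71 keep all later ones above it. This confines the values 11 and 71
-- to indices below 16.
R-large : ∀ m → 72 ≤ R (16 + m)
R-large 0 = toWitness {a? = 72 ≤? R 16} tt
R-large 1 = toWitness {a? = 72 ≤? R 17} tt
R-large 2 = toWitness {a? = 72 ≤? R 18} tt
R-large (suc (suc (suc m))) = ≤-trans (R-large m) (m≤n+m (R (16 + m)) (R (17 + m)))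

R≢11,71 : ∀ m → R m ≢ 11 × R m ≢ 71
R≢11,71 m with m <? 16
... | yes m<16 = toWitness {a? = allUpTo? (λ m → ¬? (R m ≟ 11) ×-dec ¬? (R m ≟ 71)) 16} tt m<16
... | no  m≮16 = let o , eq = m≤n⇒∃[o]m+o≡n (≮⇒≥ m≮16)
                     72≤R   = subst (λ j → 72 ≤ R j) eq (R-large o)
                 in >⇒≢ (≤-trans (m≤m+n 12 60) 72≤R) , >⇒≢ 72≤R

square-injective : ∀ {x y} → x * x ≡ y * y → x ≡ y
square-injective {x} {y} eq = ≤-antisym (≮⇒≥ λ y<x → <-irrefl (sym eq) (*-mono-< y<x y<x))
                                        (≮⇒≥ λ x<y → <-irrefl eq (*-mono-< x<y x<y))

small-solutions : ∀ {n} m → n < 53 → n ! + 1 ≡ R m * R m → n ≡ 4 × R m ≡ 5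
small-solutions {n} m n<53 = conclude {n} {root n} (near-square n<53)
  where
  conclude : ∀ {n s} → (n ≡ 4 ⊎ n ≡ 5 ⊎ n ≡ 7) ⊎ BetweenSquares s (n ! + 1) →
             n ! + 1 ≡ R m * R m → n ≡ 4 × R m ≡ 5
  conclude (inj₁ (inj₁ refl))        eq = refl , square-injective {R m} {5} (sym eq)
  conclude (inj₁ (inj₂ (inj₁ refl))) eq = contradiction (square-injective {R m} {11} (sym eq)) (proj₁ (R≢11,71 m))
  conclude (inj₁ (inj₂ (inj₂ refl))) eq = contradiction (square-injective {R m} {71} (sym eq)) (proj₂ (R≢11,71 m))
  conclude {n} {s} (inj₂ between)    eq = contradiction eq (between-squares {s} (R m) between)

-- Factorials from 53! on, and the conclusion.

no-large-solutions : ∀ {n} m → 53 ≤ n → n ! + 1 ≢ R m * R m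
no-large-solutions {n} m 53≤n eq =
  excluded (n / 3) (/-monoˡ-≤ 3 53≤n) (m≡m%n+[m/n]*n n 3)
    (∣-trans (3^∣! (n / 3)) (m≤n⇒m!∣n! (m/n*n≤m n 3)))
  where
  residue : T (admissible (m % 13))
  -- 477 = 9 · 53 divides 53! and therefore n!.
  residue = admissible-residue m (trans (cong (_% 477) (sym eq)) (%-remove-+ˡ 1
    (∣-trans (toWitness {a? = 477 ∣? 53 !} tt) (m≤n⇒m!∣n! 53≤n))))

  excluded : ∀ j → 17 ≤ j → n ≡ n % 3 + j * 3 → 3 ^ j ∣ n ! → ⊥
  -- With k + 1 = ⌊n / 3⌋, a congruence modulo 3ᵏ⁺¹ fixes `m` only modulo 13 · 3ᵏ, hence the drop
  -- from `j` to `k`.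
  excluded (suc k) (s≤s 16≤k) n≡ (divides t n!≡) = <-irrefl eq
    (!+1<R² {k} {n} {m} {3 ^ k} (≤-trans n≤3k+5 (linear≤2^ 5≤′k))
      -- The exponent bounding n! is quadratic in `k`, whereas the lower bound for the index is
      -- exponential in `k`.
      (≤-trans (+-mono-≤ (m≤m+n 2 2) (*-monoʳ-≤ k n≤3k+5)) (quadratic≤3^ 5≤′k))
      -- 31 + 1184 = 5 · 3⁵.
      (≤-trans (m≤m+n 31 1184) (*-monoˡ-≤ 5 (^-monoʳ-≤ 3 5≤k)))
      (index-large k m t sq residue))
    where
    open ≤-Reasoning
    5≤k : 5 ≤ k
    5≤k = ≤-trans (m≤m+n 5 11) 16≤k
    5≤′k : 5 ≤′ k
    5≤′k = ≤⇒≤′ 5≤k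
    regroup : ∀ k → 2 + suc k * 3 ≡ 3 * k + 5
    regroup = solve-∀
    n≤3k+5 : n ≤ 3 * k + 5
    n≤3k+5 = begin
      n                    ≡⟨ n≡ ⟩
      n % 3 + suc k * 3    ≤⟨ +-monoˡ-≤ (suc k * 3) (m<1+n⇒m≤n (m%n<n n 3)) ⟩
      2 + suc k * 3        ≡⟨ regroup k ⟩
      3 * k + 5            ∎
    sq : R m * R m ≡ 1 + 3 * 3 ^ k * t
    sq = begin-equality
      R m * R m            ≡⟨ eq ⟨
      n ! + 1              ≡⟨ +-comm (n !) 1 ⟩
      1 + n !              ≡⟨ cong (1 +_) n!≡ ⟩
      1 + t * 3 ^ suc k    ≡⟨ cong (1 +_) (*-comm t (3 ^ suc k)) ⟩
      1 + 3 * 3 ^ k * t    ∎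

theorem2 : (n x : ℕ) → (IsPerrin x × n ! + 1 ≡ x ^ 2) ⇔ (n ≡ 4 × x ≡ 5)
-- The witness 5 is an index: `R 5` has the value 5.
theorem2 n x = mk⇔ unique λ { (refl , refl) → (5 , refl) , refl }
  where
  unique : IsPerrin x × n ! + 1 ≡ x ^ 2 → n ≡ 4 × x ≡ 5
  unique ((m , refl) , eq) with n <? 53 | trans eq (cong (R m *_) (*-identityʳ (R m)))
  ... | yes n<53 | eq′ = small-solutions m n<53 eq′
  ... | no  n≮53 | eq′ = contradiction eq′ (no-large-solutions m (≮⇒≥ n≮53))
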